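{- Let $(\delta_n)_{n\in\mathbb N}$ be a sequence of numbers in $[0,1]$ such that $\lim_{n\to\infty}\delta_n=1$. If $(G_n)_{n\in\mathbb N}$ is a sequence of directed acyclic graphs with uniformly bounded in-degrees, then $(G_n)$ is not an $(n^{\delta_n})$-extender sequence.
   Context: A graph is a pair $G=(V,E)$ with $V$ a non-empty finite set and $E\subset V\times V$ disjoint from the diagonal; elements of $E$ are directed edges. The in-degree of $v$ is the number of $x$ with $(x,v)\in E$. A directed simple path of length $D\ge 0$ is a tuple $(x_0,\ldots,x_D)$ of pairwise distinct vertices with $(x_i,x_{i+1})\in E$ for all $i<D$. A directed acyclic graph (dag) is a graph with no directed cycles. For a proper subset $S\subsetneq V(G)$, $\operatorname{codepth}(S;G)\in\mathbb N$ is the maximal $D$ such that there exists a directed simple path $(x_0,\ldots,x_D)$ in $G$ disjoint from $S$. For $\varepsilon,\rho>0$, a dag $G$ is an $(\varepsilon,\rho)$-extender if for every $S\subsetneq V(G)$ with $|S|\le \varepsilon|V(G)|$ we have $\operatorname{codepth}(S;G)\ge\rho$. For a sequence $(\rho_n)$ of positive reals with $\rho_n\to\infty$, a sequence $(G_n)$ of dags with uniformly bounded in-degrees is a $(\rho_n)$-extender sequence if $|V(G_n)|\to\infty$ and there exist $\varepsilon>0$, $C>0$ such that for all $n$, $G_n$ is an $(\varepsilon, C\rho_{|V(G_n)|})$-extender. Here $\rho_n=n^{\delta_n}$ (only indices $n\ge1$ matter, as vertex sets are non-empty). -}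

module Defs where

open import Data.Fin.Base using (Fin)
import Data.Fin.Properties as Fin
open import Data.Fin.Subset using (Subset; _∉_; _⊂_; ⊤; ∣_∣)
open import Data.Fin.Subset.Properties using (_∈?_)
open import Data.Integer.Base as ℤ using (ℤ; +_; -[1+_])
import Data.Integer.Properties as ℤ
open import Data.List.Base using (length; filter; allFin)
open import Data.Nat.Base as ℕ using (ℕ; zero; suc)
open import Data.Nat.Coprimality using (1-coprimeTo) renaming (sym to coprime-sym)
import Data.Nat.Properties as ℕ
open import Data.Product.Base using (Σ; ∃; _×_; _,_; proj₁; proj₂)
open import Data.Rational.Base as ℚ using (ℚ; mkℚ; 0ℚ; 1ℚ; _/_; ↥_; ↧_; ↧ₙ_)
import Data.Rational.Properties as ℚ
open import Data.Vec.Base using (Vec; []; _∷_; head; last; lookup)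
open import Data.Vec.Relation.Unary.All as All using (All; []; _∷_)
open import Data.Vec.Relation.Unary.AllPairs using (allPairs?)
open import Data.Vec.Relation.Unary.Linked using (Linked; [-]; linked?)
open import Data.Vec.Relation.Unary.Unique.Propositional using (Unique; []; _∷_)
open import Data.Vec.Relation.Unary.Unique.Propositional.Properties using (lookup-injective)
open import Function.Base using (_∘_)
open import Level using (0ℓ)
open import Relation.Binary.Core using (Rel)
open import Relation.Binary.Definitions using (Decidable; Irreflexive; tri<; tri≈; tri>)
open import Relation.Binary.PropositionalEquality
  using (_≡_; refl; sym; trans; cong; cong₂; subst; subst₂)
open import Relation.Nullary using (¬_; Dec; yes; no; contradiction)
open import Relation.Nullary.Decidable using (map′; _×-dec_; ¬?)
import Relation.Unary as Unary

open import Algebra.Definitions.RawSemiring ℚ.+-*-rawSemiring public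
  using () renaming (_^_ to _^ℚ_)

integer : ℕ → ℚ
integer n = mkℚ (+ n) 0 (coprime-sym (1-coprimeTo n))

/1-normal : ∀ n → + n / 1 ≡ integer n
/1-normal n = ℚ.normalize-coprime (coprime-sym (1-coprimeTo n))

/1-mono : ∀ {m n} → m ℕ.≤ n → (+ m / 1) ℚ.≤ (+ n / 1)
/1-mono {m} {n} m≤n rewrite /1-normal m | /1-normal n =
  ℚ.*≤* (ℤ.*-monoʳ-≤-nonNeg (+ 1) (ℤ.+≤+ m≤n))

/1-* : ∀ m n → (+ (m ℕ.* n) / 1) ≡ (+ m / 1) ℚ.* (+ n / 1)
/1-* m n rewrite /1-normal m | /1-normal n = cong (_/ 1) (ℤ.pos-* m n)

/1-^ : ∀ m k → (+ (m ℕ.^ k) / 1) ≡ (+ m / 1) ^ℚ k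
/1-^ m zero    = refl
/1-^ m (suc k) = trans (/1-* m (m ℕ.^ k)) (cong ((+ m / 1) ℚ.*_) (/1-^ m k))

/1-positive : ∀ n .{{_ : ℕ.NonZero n}} → 0ℚ ℚ.< (+ n / 1)
/1-positive n = ℚ.positive⁻¹ _ {{ℚ.normalize-pos n 1}}

1/-≤1 : ∀ d .{{_ : ℕ.NonZero d}} → (+ 1 / d) ℚ.≤ 1ℚ
1/-≤1 (suc d) rewrite ℚ.normalize-coprime (1-coprimeTo (suc d)) =
  ℚ.*≤* (ℤ.+≤+ (ℕ.s≤s ℕ.z≤n))

*-mono-<-nonNeg : ∀ {p q r s} → 0ℚ ℚ.≤ r → 0ℚ ℚ.< q → p ℚ.< q → r ℚ.< s → p ℚ.* r ℚ.< q ℚ.* s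
*-mono-<-nonNeg {p} {q} {r} {s} 0≤r 0<q p<q r<s = ℚ.≤-<-trans
  (ℚ.*-monoʳ-≤-nonNeg r {{ℚ.nonNegative 0≤r}} (ℚ.<⇒≤ p<q))
  (ℚ.*-monoʳ-<-pos q {{ℚ.positive 0<q}} r<s)

0≤^ : ∀ {p} k → 0ℚ ℚ.≤ p → 0ℚ ℚ.≤ p ^ℚ k
0≤^ zero    0≤p = ℚ.nonNegative⁻¹ 1ℚ
0≤^ {p} (suc k) 0≤p = ℚ.nonNegative⁻¹ _
  {{ℚ.nonNeg*nonNeg⇒nonNeg p {{ℚ.nonNegative 0≤p}} (p ^ℚ k) {{ℚ.nonNegative (0≤^ k 0≤p)}}}}

^-mono-< : ∀ {p q} k → 0ℚ ℚ.≤ p → p ℚ.< q → p ^ℚ suc k ℚ.< q ^ℚ suc k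
^-mono-< {p} {q} zero    0≤p p<q =
  subst₂ ℚ._<_ (sym (ℚ.*-identityʳ p)) (sym (ℚ.*-identityʳ q)) p<q
^-mono-< (suc k) 0≤p p<q =
  *-mono-<-nonNeg (0≤^ (suc k) 0≤p) (ℚ.≤-<-trans 0≤p p<q) p<q (^-mono-< k 0≤p p<q)

p-1<p : ∀ p → p ℚ.- 1ℚ ℚ.< p
p-1<p p = subst (p ℚ.- 1ℚ ℚ.<_) (ℚ.+-identityʳ p) (ℚ.+-monoʳ-< p (ℚ.negative⁻¹ (ℚ.- 1ℚ)))

-- A real number is the lower half of a Dedekind cut: a nonempty, bounded-above,
-- downward closed set of rationals without a largest element.  Classically these
-- are the usual reals; constructively they are the (bounded) lower reals, which
-- include the located Dedekind reals.

record ℝ : Set₁ where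
  field
    _∋_      : ℚ → Set
    nonempty : ∃ λ q → _∋_ q
    bounded  : ∃ λ q → ¬ _∋_ q
    downward : ∀ {p q} → p ℚ.< q → _∋_ q → _∋_ p
    rounded  : ∀ {p} → _∋_ p → ∃ λ q → p ℚ.< q × _∋_ q

open ℝ public using (_∋_)

infix 4 _≤ℝ_ _<ℝ_

_≤ℝ_ : Rel ℝ 0ℓ
x ≤ℝ y = ∀ {q} → x ∋ q → y ∋ q

_<ℝ_ : Rel ℝ 0ℓ
x <ℝ y = ∃ λ q → y ∋ q × ¬ x ∋ q

fromℚ : ℚ → ℝ
fromℚ r = record
  { _∋_      = ℚ._< r
  ; nonempty = r ℚ.- 1ℚ , p-1<p r
  ; bounded  = r , ℚ.<-irrefl refl
  ; downward = ℚ.<-trans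
  ; rounded  = λ p<r → let q , p<q , q<r = ℚ.<-dense p<r in q , p<q , q<r
  }

fromℕ : ℕ → ℝ
fromℕ n = fromℚ (+ n / 1)

0ℝ 1ℝ : ℝ
0ℝ = fromℕ 0
1ℝ = fromℕ 1

∋∧∌⇒< : ∀ x {p q} → x ∋ p → ¬ x ∋ q → p ℚ.< q
∋∧∌⇒< x {p} {q} x∋p x∌q with ℚ.<-cmp p q
... | tri< p<q _ _    = p<q
... | tri≈ _ refl _   = contradiction x∋p x∌q
... | tri> _ _ q<p    = contradiction (ℝ.downward x q<p x∋p) x∌q

infixl 6 _+ℝ_

_+ℝ_ : ℝ → ℝ → ℝ
x +ℝ y = record
  { _∋_      = λ q → ∃ λ r → ∃ λ s → x ∋ r × y ∋ s × q ℚ.≤ r ℚ.+ s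
  ; nonempty = let r , x∋r = X.nonempty; s , y∋s = Y.nonempty in
      r ℚ.+ s , r , s , x∋r , y∋s , ℚ.≤-refl
  ; bounded  = let r₀ , x∌r₀ = X.bounded; s₀ , y∌s₀ = Y.bounded in
      r₀ ℚ.+ s₀ , λ (r , s , x∋r , y∋s , le) → ℚ.<-irrefl refl
        (ℚ.≤-<-trans le (ℚ.+-mono-< (∋∧∌⇒< x x∋r x∌r₀) (∋∧∌⇒< y y∋s y∌s₀)))
  ; downward = λ p<q (r , s , x∋r , y∋s , le) →
      r , s , x∋r , y∋s , ℚ.≤-trans (ℚ.<⇒≤ p<q) le
  ; rounded  = λ (r , s , x∋r , y∋s , le) → let r′ , r<r′ , x∋r′ = X.rounded x∋r in
      r′ ℚ.+ s , ℚ.≤-<-trans le (ℚ.+-monoˡ-< s r<r′) , r′ , s , x∋r′ , y∋s , ℚ.≤-refl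
  }
  where
    module X = ℝ x
    module Y = ℝ y

record ℝ⁺ : Set₁ where
  field
    value    : ℝ
    positive : 0ℝ <ℝ value

open ℝ⁺ public using (value)

fromℕ⁺ : (n : ℕ) .{{_ : ℕ.NonZero n}} → ℝ⁺
fromℕ⁺ n = record
  { value    = fromℕ n
  ; positive = 0ℚ , /1-positive n , ℚ.<-irrefl refl
  }

positive-rational : ∀ x → ∃ λ q → 0ℚ ℚ.< q × value x ∋ q
positive-rational x =
  let q , x∋q , q≮0 = ℝ⁺.positive x
      r , q<r , x∋r = ℝ.rounded (value x) x∋q
  in r , ℚ.≤-<-trans (ℚ.≮⇒≥ q≮0) q<r , x∋r

infixl 7 _*⁺_

_*⁺_ : ℝ⁺ → ℝ⁺ → ℝ⁺
x *⁺ y = record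
  { value = record
    { _∋_      = λ q → ∃ λ r → ∃ λ s →
        0ℚ ℚ.< r × 0ℚ ℚ.< s × value x ∋ r × value y ∋ s × q ℚ.≤ r ℚ.* s
    ; nonempty = 0ℚ , zero∈
    ; bounded  = let r₀ , x∌r₀ = X.bounded; s₀ , y∌s₀ = Y.bounded in
        r₀ ℚ.* s₀ , λ (r , s , 0<r , 0<s , x∋r , y∋s , le) →
          let r<r₀ = ∋∧∌⇒< (value x) x∋r x∌r₀ in
          ℚ.<-irrefl refl (ℚ.≤-<-trans le
            (*-mono-<-nonNeg (ℚ.<⇒≤ 0<s) (ℚ.<-trans 0<r r<r₀) r<r₀ (∋∧∌⇒< (value y) y∋s y∌s₀)))
    ; downward = λ p<q (r , s , 0<r , 0<s , x∋r , y∋s , le) →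
        r , s , 0<r , 0<s , x∋r , y∋s , ℚ.≤-trans (ℚ.<⇒≤ p<q) le
    ; rounded  = λ (r , s , 0<r , 0<s , x∋r , y∋s , le) →
        let r′ , r<r′ , x∋r′ = X.rounded x∋r in
        r′ ℚ.* s ,
        ℚ.≤-<-trans le (ℚ.*-monoˡ-<-pos s {{ℚ.positive 0<s}} r<r′) ,
        r′ , s , ℚ.<-trans 0<r r<r′ , 0<s , x∋r′ , y∋s , ℚ.≤-refl
    }
  ; positive = 0ℚ , zero∈ , ℚ.<-irrefl refl
  }
  where
    module X = ℝ (value x)
    module Y = ℝ (value y)

    zero∈ : ∃ λ r → ∃ λ s →
      0ℚ ℚ.< r × 0ℚ ℚ.< s × value x ∋ r × value y ∋ s × 0ℚ ℚ.≤ r ℚ.* s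
    zero∈ =
      let r , 0<r , x∋r = positive-rational x
          s , 0<s , y∋s = positive-rational y
      in r , s , 0<r , 0<s , x∋r , y∋s , ℚ.<⇒≤ (ℚ.positive⁻¹ _
           {{ℚ.pos*pos⇒pos r {{ℚ.positive 0<r}} s {{ℚ.positive 0<s}}}})

infixr 8 _^ℤ_ _^ℝ_

_^ℤ_ : (n : ℕ) .{{_ : ℕ.NonZero n}} → ℤ → ℚ
n ^ℤ (+ k)    = + (n ℕ.^ k) / 1
n ^ℤ -[1+ k ] = (+ 1 / (n ℕ.^ suc k)) {{ℕ.m^n≢0 n (suc k)}}

^ℤ-positive : ∀ n .{{_ : ℕ.NonZero n}} i → 0ℚ ℚ.< n ^ℤ i
^ℤ-positive n (+ k)    = /1-positive (n ℕ.^ k) {{ℕ.m^n≢0 n k}}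
^ℤ-positive n -[1+ k ] = ℚ.positive⁻¹ _ {{ℚ.normalize-pos 1 (n ℕ.^ suc k) {{ℕ.m^n≢0 n (suc k)}}}}

^ℤ-≤ : ∀ n .{{_ : ℕ.NonZero n}} {i} k → i ℤ.≤ + k → n ^ℤ i ℚ.≤ (+ (n ℕ.^ k) / 1)
^ℤ-≤ n k (ℤ.+≤+ j≤k)         = /1-mono (ℕ.^-monoʳ-≤ n j≤k)
^ℤ-≤ n k (ℤ.-≤+ {m = j})     = ℚ.≤-trans (1/-≤1 (n ℕ.^ suc j) {{ℕ.m^n≢0 n (suc j)}})
                                 (/1-mono {1} (ℕ.>-nonZero⁻¹ _ {{ℕ.m^n≢0 n k}}))

i≤∣i∣ : ∀ i → i ℤ.≤ + ℤ.∣ i ∣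
i≤∣i∣ (+ n)    = ℤ.≤-refl
i≤∣i∣ -[1+ n ] = ℤ.-≤+

numerator-bound : ∀ {a s} → a ℚ.< s → ↥ a ℤ.≤ + (ℤ.∣ ↥ s ∣ ℕ.* ↧ₙ a)
numerator-bound {mkℚ -[1+ _ ] _ _} _ = ℤ.-≤+
numerator-bound {mkℚ (+ m) d c} {s} (ℚ.*<* lt) = begin
  + m                               ≤⟨ ℤ.+≤+ (ℕ.m≤m*n m (↧ₙ s)) ⟩
  + (m ℕ.* ↧ₙ s)                    ≡⟨ ℤ.pos-* m (↧ₙ s) ⟩
  + m ℤ.* ↧ s                       ≤⟨ ℤ.<⇒≤ lt ⟩
  ↥ s ℤ.* + suc d                   ≤⟨ ℤ.*-monoʳ-≤-nonNeg (+ suc d) (i≤∣i∣ (↥ s)) ⟩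
  + ℤ.∣ ↥ s ∣ ℤ.* + suc d           ≡⟨ ℤ.pos-* ℤ.∣ ↥ s ∣ (suc d) ⟨
  + (ℤ.∣ ↥ s ∣ ℕ.* suc d)           ∎
  where open ℤ.≤-Reasoning

negative-integer : ℕ → ℚ
negative-integer k = mkℚ -[1+ k ] 0 (coprime-sym (1-coprimeTo (suc k)))

negative-integer-< : ∀ a → negative-integer ℤ.∣ ↥ a ∣ ℚ.< a
negative-integer-< (mkℚ (+ m) d c)    = ℚ.*<* (subst (-[1+ d ℕ.+ m ℕ.* suc d ] ℤ.<_) (sym (ℤ.*-identityʳ (+ m))) ℤ.-<+)
negative-integer-< (mkℚ -[1+ m ] d c) = ℚ.*<* (subst (-[1+ suc m ] ℤ.* + suc d ℤ.<_)
  (sym (ℤ.*-identityʳ -[1+ m ])) (ℤ.-<- (ℕ.<-≤-trans (ℕ.n<1+n m)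
    (ℕ.≤-trans (ℕ.m≤m*n (suc m) (suc d)) (ℕ.m≤n+m _ d)))))

-- n ^ x for n ≥ 1 is the supremum of the n ^ a over rationals a < x; for r ≥ 0 the
-- condition r ≤ n ^ a is stated as r ^ (denominator a) ≤ n ^ (numerator a).

_^ℝ_ : (n : ℕ) .{{_ : ℕ.NonZero n}} → ℝ → ℝ⁺
n ^ℝ x = record
  { value = record
    { _∋_      = λ q → ∃ λ r → ∃ λ a →
        q ℚ.< r × 0ℚ ℚ.≤ r × x ∋ a × r ^ℚ (↧ₙ a) ℚ.≤ n ^ℤ (↥ a)
    ; nonempty = 0ℚ , zero∈
    ; bounded  = let s , x∌s = X.bounded; k = ℤ.∣ ↥ s ∣ in
        (+ (n ℕ.^ k) / 1) , λ (r , a , n^k<r , _ , x∋a , le) →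
          ℚ.<-irrefl refl (ℚ.<-≤-trans
            (^-mono-< (ℕ.pred (↧ₙ a)) (ℚ.<⇒≤ (^ℤ-positive n (+ k))) n^k<r)
            (ℚ.≤-trans le (ℚ.≤-trans
              (^ℤ-≤ n (k ℕ.* ↧ₙ a) (numerator-bound (∋∧∌⇒< x x∋a x∌s)))
              (ℚ.≤-reflexive (trans
                (cong (λ m → + m / 1) (sym (ℕ.^-*-assoc n k (↧ₙ a))))
                (/1-^ (n ℕ.^ k) (↧ₙ a)))))))
    ; downward = λ p<q (r , a , q<r , rest) → r , a , ℚ.<-trans p<q q<r , rest
    ; rounded  = λ (r , a , q<r , rest) → let q′ , q<q′ , q′<r = ℚ.<-dense q<r in
        q′ , q<q′ , r , a , q′<r , rest
    }
  ; positive = 0ℚ , zero∈ , ℚ.<-irrefl refl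
  }
  where
    module X = ℝ x

    zero∈ : ∃ λ r → ∃ λ a →
      0ℚ ℚ.< r × 0ℚ ℚ.≤ r × x ∋ a × r ^ℚ (↧ₙ a) ℚ.≤ n ^ℤ (↥ a)
    zero∈ =
      let a , x∋a = X.nonempty
          k = ℤ.∣ ↥ a ∣
          0<n^-k = ^ℤ-positive n -[1+ k ]
      in n ^ℤ -[1+ k ] , negative-integer k , 0<n^-k , ℚ.<⇒≤ 0<n^-k ,
         X.downward (negative-integer-< a) x∋a , ℚ.≤-reflexive (ℚ.*-identityʳ _)

-- The two inequalities together say ∣ x n - ℓ ∣ < η.

ConvergesTo : (ℕ → ℝ) → ℝ → Set₁
ConvergesTo x ℓ = (η : ℝ⁺) → ∃ λ N → ∀ n → N ℕ.≤ n →
  ℓ <ℝ x n +ℝ value η × x n <ℝ ℓ +ℝ value η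

record Graph : Set₁ where
  infix 4 _⟶_ _⟶?_
  field
    size        : ℕ
    {{nonEmpty}} : ℕ.NonZero size
    _⟶_         : Rel (Fin size) 0ℓ
    _⟶?_        : Decidable _⟶_
    loopless    : Irreflexive _≡_ _⟶_

  Vertex : Set
  Vertex = Fin size

  inDegree : Vertex → ℕ
  inDegree v = length (filter (_⟶? v) (allFin size))

  IsSimplePath : ∀ {D} → Vec Vertex (suc D) → Set
  IsSimplePath xs = Unique xs × Linked _⟶_ xs

  -- Looplessness excludes D = 0.
  IsDirectedCycle : ∀ {D} → Vec Vertex (suc D) → Set
  IsDirectedCycle xs = IsSimplePath xs × last xs ⟶ head xs

  PathAvoiding : Subset size → ℕ → Set
  PathAvoiding S D = Σ (Vec Vertex (suc D)) λ xs → IsSimplePath xs × All (_∉ S) xs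

  IsCodepth : Subset size → ℕ → Set
  IsCodepth S D = PathAvoiding S D × (∀ {D′} → PathAvoiding S D′ → D′ ℕ.≤ D)

∃Vec? : ∀ {n} k {P : Vec (Fin n) k → Set} → Unary.Decidable P → Dec (∃ P)
∃Vec? zero    P? = map′ (λ p → [] , p) (λ { ([] , p) → p }) (P? [])
∃Vec? (suc k) P? = map′
  (λ (x , xs , p) → x ∷ xs , p)
  (λ { (x ∷ xs , p) → x , xs , p })
  (Fin.any? λ x → ∃Vec? k (P? ∘ (x ∷_)))

maximum : {P : ℕ → Set} → Unary.Decidable P → ∀ b → (∀ {D} → P D → D ℕ.≤ b) →
          ∃ P → ∃ λ D → P D × (∀ {D′} → P D′ → D′ ℕ.≤ D)
maximum P? b P≤b p with P? b
maximum P? b       P≤b p       | yes Pb = b , Pb , P≤b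
maximum P? zero    P≤b (D , p) | no ¬Pb with P≤b p
... | ℕ.z≤n = contradiction p ¬Pb
maximum P? (suc b) P≤b p       | no ¬Pb = maximum P? b
  (λ {D} q → ℕ.≤-pred (ℕ.≤∧≢⇒< (P≤b q) λ { refl → ¬Pb q })) p

module _ (G : Graph) where
  open Graph G

  private
    pathAvoiding? : ∀ S → Unary.Decidable (PathAvoiding S)
    pathAvoiding? S D = ∃Vec? (suc D) λ xs →
      (allPairs? (λ x y → ¬? (x Fin.≟ y)) xs ×-dec linked? _⟶?_ xs)
      ×-dec All.all? (λ x → ¬? (x ∈? S)) xs

    length≤size : ∀ {S D} → PathAvoiding S D → D ℕ.≤ size
    length≤size (xs , (unique , _) , _) =
      ℕ.<⇒≤ (Fin.injective⇒≤ {f = lookup xs} (lookup-injective unique _ _))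

  codepth-exists : ∀ {S} → S ⊂ ⊤ → ∃ (IsCodepth S)
  codepth-exists {S} (_ , x , _ , x∉S) = maximum (pathAvoiding? S) size length≤size
    (0 , x ∷ [] , ([] ∷ [] , [-]) , x∉S ∷ [])

  codepth : (S : Subset size) → S ⊂ ⊤ → ℕ
  codepth S S⊂V = proj₁ (codepth-exists S⊂V)

record DAG : Set₁ where
  field
    graph   : Graph
  open Graph graph public
  field
    acyclic : ∀ {D} (xs : Vec Vertex (suc D)) → ¬ IsDirectedCycle xs

open DAG public using (graph; size; inDegree)

IsExtender : ℝ⁺ → ℝ⁺ → DAG → Set
IsExtender ε ρ G = ∀ S (S⊂V : S ⊂ ⊤) →
  fromℕ ∣ S ∣ ≤ℝ value (ε *⁺ fromℕ⁺ (size G) {{DAG.nonEmpty G}}) →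
  value ρ ≤ℝ fromℕ (codepth (graph G) S S⊂V)

UniformlyBoundedInDegree : (ℕ → DAG) → Set
UniformlyBoundedInDegree G = ∃ λ B → ∀ n v → inDegree (G n) v ℕ.≤ B

-- The notion is of interest when ρ tends to infinity and the in-degrees in G are
-- uniformly bounded; neither is part of the predicate.

IsExtenderSequence : ((n : ℕ) .{{_ : ℕ.NonZero n}} → ℝ⁺) → (ℕ → DAG) → Set₁
IsExtenderSequence ρ G =
  (∀ M → ∃ λ N → ∀ n → N ℕ.≤ n → M ℕ.≤ size (G n)) ×
  Σ ℝ⁺ λ ε → Σ ℝ⁺ λ C → ∀ n →
    IsExtender ε (C *⁺ ρ (size (G n)) {{DAG.nonEmpty (G n)}}) (G n)

{-# OPTIONS --safe #-}

-- Depth reduction, after Erdős–Graham–Szemerédi and Valiant.  Let h v be the length of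
-- a longest path from v, written with g + 1 digits in a base Q, where |V| ≤ Q ^ (g + 1).
-- Each edge has one leading digit in which the heights of its ends differ, so the edges
-- fall into g + 1 classes, and removing the heads of the edges of a smallest class costs
-- at most B |V| / (g + 1) vertices, B being the in-degree bound.  Along the surviving
-- edges the heights still descend after deletion of that digit, so a path avoiding the
-- removed vertices is shorter than Q ^ g, about |V| ^ (1 - 1 / (g + 1)).  With g + 1 of
-- order B / ε this contradicts a lower bound of order |V| ^ δ with δ → 1.

module Submission where

open import Defs
open import Data.Bool.Base using (Bool; true; false; _∧_; _∨_; if_then_else_)
open import Data.Fin.Base using (Fin; zero; suc)
import Data.Fin.Properties as Fin
open import Data.Fin.Subset using (Subset; _∈_; _∉_; _⊂_; ⊤; ∣_∣)
open import Data.Fin.Subset.Properties using (_∈?_; ∈⊤; ⊆⊤; ⊆-antisym; ∣⊤∣≡n)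
open import Data.Integer.Base as ℤ using (+_; -[1+_])
import Data.Integer.Properties as ℤ
open import Data.List.Base as List using (length; filter)
open import Data.Nat.Base as ℕ using (ℕ; zero; suc; NonZero; z≤n; s≤s)
open import Data.Nat.Coprimality using (1-coprimeTo)
import Data.Nat.DivMod as ℕ
open import Data.Nat.Divisibility using (_∣_; ∣1⇒≡1; ∣m+n∣m⇒∣n)
import Data.Nat.Properties as ℕ
open import Data.Product.Base using (Σ; ∃; _×_; _,_; proj₁; proj₂)
open import Data.Rational.Base as ℚ using (ℚ; mkℚ; 0ℚ; 1ℚ; _/_)
import Data.Rational.Properties as ℚ
open import Data.Sum.Base using (inj₁; inj₂)
open import Data.Vec.Base using (Vec; []; _∷_; head; last; lookup; tabulate)
open import Data.Vec.Relation.Unary.All using (All; []; _∷_)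
open import Data.Vec.Relation.Unary.All.Properties using (lookup⁻)
open import Data.Vec.Relation.Unary.AllPairs using ([]; _∷_; allPairs?)
open import Data.Vec.Relation.Unary.Any using (here; there)
import Data.Vec.Membership.Propositional as Vec
open import Data.Vec.Membership.Propositional.Properties using (∈-lookup)
open import Data.Vec.Properties using (lookup∘tabulate; lookup⇒[]=)
open import Data.Vec.Relation.Unary.Linked using (Linked; []; [-]; _∷_; linked?)
open import Data.Vec.Relation.Unary.Unique.Propositional.Properties using (lookup-injective)
open import Function.Base using (_∘_; it)
open import Relation.Binary.PropositionalEquality
open import Relation.Nullary using (¬_; Dec; does; yes; no; contradiction)
open import Relation.Nullary.Decidable using (_×-dec_; ¬?; dec-true; dec-false; decidable-stable)
import Relation.Unary as Unary
open import Algebra.Properties.CommutativeMonoid.Sum ℕ.+-0-commutativeMonoid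
  using (sum; sum-cong-≗; ∑-comm)

-- Finite sums of natural numbers

sum-mono : ∀ {n} {f g : Fin n → ℕ} → (∀ i → f i ℕ.≤ g i) → sum f ℕ.≤ sum g
sum-mono {zero}  f≤g = z≤n
sum-mono {suc n} f≤g = ℕ.+-mono-≤ (f≤g zero) (sum-mono (f≤g ∘ suc))

sum-≤-const : ∀ {n} {f : Fin n → ℕ} {c} → (∀ i → f i ℕ.≤ c) → sum f ℕ.≤ n ℕ.* c
sum-≤-const {zero}  f≤c = z≤n
sum-≤-const {suc n} f≤c = ℕ.+-mono-≤ (f≤c zero) (sum-≤-const (f≤c ∘ suc))

below-average : ∀ {n} (f : Fin (suc n) → ℕ) → ∃ λ i → suc n ℕ.* f i ℕ.≤ sum f
below-average {zero}  f = zero , ℕ.≤-refl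
below-average {suc n} f with below-average (f ∘ suc)
... | i , le with ℕ.≤-total (f zero) (f (suc i))
...   | inj₁ f₀≤fᵢ = zero , ℕ.+-monoʳ-≤ (f zero) (ℕ.≤-trans (ℕ.*-monoʳ-≤ (suc n) f₀≤fᵢ) le)
...   | inj₂ fᵢ≤f₀ = suc i , ℕ.+-mono-≤ fᵢ≤f₀ le

𝟙 : Bool → ℕ
𝟙 b = if b then 1 else 0

𝟙-∨ : ∀ a b → 𝟙 (a ∨ b) ℕ.≤ 𝟙 a ℕ.+ 𝟙 b
𝟙-∨ true  b = s≤s z≤n
𝟙-∨ false b = ℕ.≤-refl

𝟙-does-+ : ∀ {P : Set} (P? : Dec P) {s} → (P → s ℕ.≤ 0) → s ℕ.≤ 1 → 𝟙 (does P?) ℕ.+ s ℕ.≤ 1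
𝟙-does-+ (yes p) s≤0 _   = s≤s (s≤0 p)
𝟙-does-+ (no _)  _   s≤1 = s≤1

-- Here `a` will decide an edge and `b i` its class: exclusive classes count an edge at most once
-- and a non-edge never.
sum-𝟙-∧ : ∀ {n} a (b : Fin n → Bool) → sum (𝟙 ∘ b) ℕ.≤ 1 → sum (λ i → 𝟙 (a ∧ b i)) ℕ.≤ 𝟙 a
sum-𝟙-∧     true  b le = le
sum-𝟙-∧ {n} false b le = ℕ.≤-trans (sum-≤-const {n} (λ _ → ℕ.≤-refl)) (ℕ.≤-reflexive (ℕ.*-zeroʳ n))

𝟙-any? : ∀ {n} {P : Fin n → Set} (P? : Unary.Decidable P) →
         𝟙 (does (Fin.any? P?)) ℕ.≤ sum (λ x → 𝟙 (does (P? x)))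
𝟙-any? {zero}  P? = z≤n
𝟙-any? {suc n} P? = ℕ.≤-trans
  (𝟙-∨ (does (P? zero)) (does (Fin.any? (P? ∘ suc))))
  (ℕ.+-monoʳ-≤ (𝟙 (does (P? zero))) (𝟙-any? (P? ∘ suc)))

∣tabulate∣ : ∀ {n} (f : Fin n → Bool) → ∣ tabulate f ∣ ≡ sum (𝟙 ∘ f)
∣tabulate∣ {zero}  f = refl
∣tabulate∣ {suc n} f with f zero
... | true  = cong suc (∣tabulate∣ (f ∘ suc))
... | false = ∣tabulate∣ (f ∘ suc)

length-filter-tabulate : ∀ {n} {A : Set} {P : A → Set} (P? : Unary.Decidable P) (f : Fin n → A) →
                         length (filter P? (List.tabulate f)) ≡ sum (λ i → 𝟙 (does (P? (f i))))
length-filter-tabulate {zero}  P? f = refl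
length-filter-tabulate {suc n} P? f with P? (f zero)
... | yes _ = cong suc (length-filter-tabulate P? (f ∘ suc))
... | no  _ = length-filter-tabulate P? (f ∘ suc)

∣p∣<n⇒p⊂⊤ : ∀ {n} {p : Subset n} → ∣ p ∣ ℕ.< n → p ⊂ ⊤
∣p∣<n⇒p⊂⊤ {n} {p} ∣p∣<n with Fin.any? (λ x → ¬? (x ∈? p))
... | yes (x , x∉p) = ⊆⊤ , x , ∈⊤ , x∉p
... | no  ¬∃∉ = contradiction
  (trans (cong ∣_∣ (⊆-antisym ⊆⊤ (λ {x} _ → decidable-stable (x ∈? p) (λ x∉p → ¬∃∉ (x , x∉p))))) (∣⊤∣≡n n))
  (ℕ.<⇒≢ ∣p∣<n)

-- Digits

module Digits (Q : ℕ) .{{_ : NonZero Q}} where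

  deleteDigit : ∀ {g} → Fin g → ℕ → ℕ
  deleteDigit zero    x = x ℕ./ Q
  deleteDigit (suc i) x = x ℕ.% Q ℕ.+ deleteDigit i (x ℕ./ Q) ℕ.* Q

  -- The digits are numbered from the least significant one.
  LeadingDifference : ∀ {g} → Fin g → ℕ → ℕ → Set
  LeadingDifference zero    x y = x ℕ./ Q ≡ y ℕ./ Q × x ≢ y
  LeadingDifference (suc i) x y = LeadingDifference i (x ℕ./ Q) (y ℕ./ Q)

  leadingDifference? : ∀ {g} (i : Fin g) x y → Dec (LeadingDifference i x y)
  leadingDifference? zero    x y = (x ℕ./ Q ℕ.≟ y ℕ./ Q) ×-dec ¬? (x ℕ.≟ y)
  leadingDifference? (suc i) x y = leadingDifference? i (x ℕ./ Q) (y ℕ./ Q)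

  ¬leadingDifference-≡ : ∀ {g} (i : Fin g) {x y} → x ≡ y → ¬ LeadingDifference i x y
  ¬leadingDifference-≡ zero    x≡y (_ , x≢y) = x≢y x≡y
  ¬leadingDifference-≡ (suc i) x≡y           = ¬leadingDifference-≡ i (cong (ℕ._/ Q) x≡y)

  -- If the quotients by `Q` agree, no higher position can lead; otherwise position zero cannot, and
  -- induction applies to the quotients.
  leadingDifference-unique : ∀ g x y → sum (λ (i : Fin g) → 𝟙 (does (leadingDifference? i x y))) ℕ.≤ 1
  leadingDifference-unique zero    x y = z≤n
  leadingDifference-unique (suc g) x y = 𝟙-does-+ (leadingDifference? (zero {n = g}) x y)
    (λ (x/Q≡y/Q , _) → ℕ.≤-trans
      (sum-≤-const {g} λ i → ℕ.≤-reflexive (cong 𝟙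
        (dec-false (leadingDifference? i _ _) (¬leadingDifference-≡ i x/Q≡y/Q))))
      (ℕ.≤-reflexive (ℕ.*-zeroʳ g)))
    (leadingDifference-unique g (x ℕ./ Q) (y ℕ./ Q))

  private
    carry : ∀ {r c d} e → r ℕ.< Q → c ℕ.< d → r ℕ.+ c ℕ.* Q ℕ.< e ℕ.+ d ℕ.* Q
    carry {r} {c} {d} e r<Q c<d = begin-strict
      r ℕ.+ c ℕ.* Q  <⟨ ℕ.+-monoˡ-< (c ℕ.* Q) r<Q ⟩
      suc c ℕ.* Q    ≤⟨ ℕ.*-monoˡ-≤ Q c<d ⟩
      d ℕ.* Q        ≤⟨ ℕ.m≤n+m (d ℕ.* Q) e ⟩
      e ℕ.+ d ℕ.* Q  ∎
      where open ℕ.≤-Reasoning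

  -- The leading difference decides the order, and it survives the deletion. If the quotients
  -- differ, induction orders them and `carry` makes the low digit irrelevant; if they agree, the
  -- low digit decides and is kept.
  deleteDigit-mono-< : ∀ {g} (i : Fin g) {x y} → x ℕ.< y → ¬ LeadingDifference i x y →
                       deleteDigit i x ℕ.< deleteDigit i y
  deleteDigit-mono-< zero {x} {y} x<y ¬leading =
    ℕ.≤∧≢⇒< (ℕ./-monoˡ-≤ Q (ℕ.<⇒≤ x<y)) (λ eq → ¬leading (eq , ℕ.<⇒≢ x<y))
  deleteDigit-mono-< (suc i) {x} {y} x<y ¬leading with x ℕ./ Q ℕ.≟ y ℕ./ Q
  ... | no  x/Q≢y/Q = carry (y ℕ.% Q) (ℕ.m%n<n x Q)
    (deleteDigit-mono-< i (ℕ.≤∧≢⇒< (ℕ./-monoˡ-≤ Q (ℕ.<⇒≤ x<y)) x/Q≢y/Q) ¬leading)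
  ... | yes x/Q≡y/Q rewrite x/Q≡y/Q = ℕ.+-monoˡ-< _ (ℕ.+-cancelʳ-< (y ℕ./ Q ℕ.* Q) (x ℕ.% Q) (y ℕ.% Q) (begin-strict
      x ℕ.% Q ℕ.+ y ℕ./ Q ℕ.* Q  ≡⟨ cong (λ q → x ℕ.% Q ℕ.+ q ℕ.* Q) x/Q≡y/Q ⟨
      x ℕ.% Q ℕ.+ x ℕ./ Q ℕ.* Q  ≡⟨ ℕ.m≡m%n+[m/n]*n x Q ⟨
      x                          <⟨ x<y ⟩
      y                          ≡⟨ ℕ.m≡m%n+[m/n]*n y Q ⟩
      y ℕ.% Q ℕ.+ y ℕ./ Q ℕ.* Q  ∎))
    where open ℕ.≤-Reasoning

  deleteDigit-< : ∀ {g} (i : Fin (suc g)) {x} → x ℕ.< Q ℕ.^ suc g → deleteDigit i x ℕ.< Q ℕ.^ g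
  deleteDigit-< {g} i {x} x<Q^1+g with ℕ.m<n*o⇒m/o<n {n = Q ℕ.^ g} (subst (x ℕ.<_) (ℕ.*-comm Q (Q ℕ.^ g)) x<Q^1+g)
  deleteDigit-< {g}     zero    _ | x/Q<Q^g = x/Q<Q^g
  deleteDigit-< {suc g} (suc i) {x} _ | x/Q<Q^g = subst (deleteDigit (suc i) x ℕ.<_) (ℕ.*-comm (Q ℕ.^ g) Q)
    (carry 0 (ℕ.m%n<n x Q) (deleteDigit-< i x/Q<Q^g))

-- Heights in acyclic graphs

module _ (G : DAG) where
  open DAG G hiding (graph; size; inDegree)

  -- The initial segment ending at `y`. Its last component passes vertex properties on to the
  -- segment, which keeps it free of repetitions.
  simplePathTo : ∀ {D} {xs : Vec Vertex (suc D)} {y} → IsSimplePath xs → y Vec.∈ xs →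
    ∃ λ E → Σ (Vec Vertex (suc E)) λ ys →
      IsSimplePath ys × head ys ≡ head xs × last ys ≡ y × (∀ {P : Vertex → Set} → All P xs → All P ys)
  simplePathTo {xs = x ∷ xs} _ (here y≡x) =
    0 , x ∷ [] , ([] ∷ [] , [-]) , refl , sym y≡x , λ { (px ∷ _) → px ∷ [] }
  simplePathTo {xs = x ∷ x′ ∷ xs} (x∉ ∷ unique , edge ∷ linked) (there y∈xs)
    with simplePathTo (unique , linked) y∈xs
  ... | E , ys , (unique′ , linked′) , head≡ , last≡ , restrict =
    suc E , x ∷ ys , (restrict x∉ ∷ unique′ , subst (x ⟶_) (sym head≡) edge ∷ linked′) ,
    refl , last≡ , λ { (px ∷ pxs) → px ∷ restrict pxs }

  SimplePathFrom : Vertex → ℕ → Set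
  SimplePathFrom v D = Σ (Vec Vertex (suc D)) λ xs → IsSimplePath xs × head xs ≡ v

  extendPath : ∀ {x v D} → x ⟶ v → SimplePathFrom v D → SimplePathFrom x (suc D)
  extendPath {x} {v} x⟶v (xs , path@(unique , linked) , refl) =
    x ∷ xs , (lookup⁻ x≢ ∷ unique , x⟶v ∷ linked) , refl
    where
      -- If `x` were on the path, the segment from `v` to `x` would close up with the edge `x ⟶ v`
      -- to a directed cycle.
      x≢ : ∀ i → x ≢ lookup xs i
      x≢ i x≡xsᵢ with simplePathTo path (∈-lookup i xs)
      ... | E , ys , path′ , head≡ , last≡ , _ =
        acyclic ys (path′ , subst₂ _⟶_ (trans x≡xsᵢ (sym last≡)) (sym head≡) x⟶v)

  private
    simplePathFrom-< : ∀ {v D} → SimplePathFrom v D → D ℕ.< size G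
    simplePathFrom-< (xs , (unique , _) , _) =
      Fin.injective⇒≤ {f = lookup xs} (lookup-injective unique _ _)

    abstract
      longestPathFrom : ∀ v → ∃ λ D → SimplePathFrom v D × (∀ {D′} → SimplePathFrom v D′ → D′ ℕ.≤ D)
      longestPathFrom v = maximum
        (λ D → ∃Vec? (suc D) λ xs →
          (allPairs? (λ x y → ¬? (x Fin.≟ y)) xs ×-dec linked? _⟶?_ xs) ×-dec (head xs Fin.≟ v))
        (size G) (ℕ.<⇒≤ ∘ simplePathFrom-<) (0 , v ∷ [] , ([] ∷ [] , [-]) , refl)

  height : Vertex → ℕ
  height v = proj₁ (longestPathFrom v)

  height<size : ∀ v → height v ℕ.< size G
  height<size v = simplePathFrom-< (proj₁ (proj₂ (longestPathFrom v)))

  height-decreases : ∀ {x v} → x ⟶ v → height v ℕ.< height x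
  height-decreases {x} {v} x⟶v =
    proj₂ (proj₂ (longestPathFrom x)) (extendPath x⟶v (proj₁ (proj₂ (longestPathFrom v))))

descending-length : ∀ {V : Set} (f : V → ℕ) {D} {xs : Vec V (suc D)} → Linked (λ x y → f y ℕ.< f x) xs → D ℕ.≤ f (head xs)
descending-length f [-]                             = z≤n
descending-length f (_∷_ {xs = _ ∷ _} fy<fx linked) = ℕ.≤-trans (s≤s (descending-length f linked)) fy<fx

-- Depth reduction

module DepthReduction (G : DAG) (Q : ℕ) .{{_ : NonZero Q}} {g : ℕ} (size≤ : size G ℕ.≤ Q ℕ.^ suc g) where
  open DAG G hiding (graph; size; inDegree)
  open Digits Q

  -- The edges of class `i`, with the head `v` first because heads are what gets removed.
  Cut : Fin (suc g) → Vertex → Vertex → Set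
  Cut i v x = x ⟶ v × LeadingDifference i (height G v) (height G x)

  cut? : ∀ i v x → Dec (Cut i v x)
  cut? i v x = (x ⟶? v) ×-dec leadingDifference? i (height G v) (height G x)

  cutHeads : Fin (suc g) → Subset (size G)
  cutHeads i = tabulate λ v → does (Fin.any? (cut? i v))

  ∈cutHeads : ∀ {i v x} → Cut i v x → v ∈ cutHeads i
  ∈cutHeads {i} {v} cut = lookup⇒[]= v (cutHeads i)
    (trans (lookup∘tabulate _ v) (dec-true (Fin.any? (cut? i v)) (_ , cut)))

  -- Double counting: each head in a cut is charged to an edge of that class, no edge lies in two
  -- classes, and the in-degrees sum to at most `size G ℕ.* B`.
  sum-∣cutHeads∣ : ∀ {B} → (∀ v → inDegree G v ℕ.≤ B) → sum (λ i → ∣ cutHeads i ∣) ℕ.≤ size G ℕ.* B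
  sum-∣cutHeads∣ {B} inDegree≤B = begin
    sum (λ i → ∣ cutHeads i ∣)
      ≡⟨ sum-cong-≗ (λ i → ∣tabulate∣ (λ v → does (Fin.any? (cut? i v)))) ⟩
    sum (λ i → sum λ v → 𝟙 (does (Fin.any? (cut? i v))))
      ≤⟨ sum-mono (λ i → sum-mono λ v → 𝟙-any? (cut? i v)) ⟩
    sum (λ i → sum λ v → sum λ x → 𝟙 (does (cut? i v x)))
      ≡⟨ ∑-comm (λ i v → sum λ x → 𝟙 (does (cut? i v x))) ⟩
    sum (λ v → sum λ i → sum λ x → 𝟙 (does (cut? i v x)))
      ≡⟨ sum-cong-≗ (λ v → ∑-comm (λ i x → 𝟙 (does (cut? i v x)))) ⟩
    sum (λ v → sum λ x → sum λ i → 𝟙 (does (cut? i v x)))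
      ≤⟨ sum-mono (λ v → sum-mono λ x → sum-𝟙-∧ (does (x ⟶? v))
           (λ i → does (leadingDifference? {suc g} i (height G v) (height G x)))
           (leadingDifference-unique (suc g) (height G v) (height G x))) ⟩
    sum (λ v → sum λ x → 𝟙 (does (x ⟶? v)))
      ≡⟨ sum-cong-≗ (λ v → sym (length-filter-tabulate (_⟶? v) (λ x → x))) ⟩
    sum (inDegree G)
      ≤⟨ sum-≤-const inDegree≤B ⟩
    size G ℕ.* B ∎
    where open ℕ.≤-Reasoning

  smallCut : ∀ {B} → (∀ v → inDegree G v ℕ.≤ B) → ∃ λ i → suc g ℕ.* ∣ cutHeads i ∣ ℕ.≤ size G ℕ.* B
  smallCut inDegree≤B with below-average (λ i → ∣ cutHeads i ∣)
  ... | i , le = i , ℕ.≤-trans le (sum-∣cutHeads∣ inDegree≤B)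

  path-avoiding-cut : ∀ i {D} → Graph.PathAvoiding (graph G) (cutHeads i) D → D ℕ.< Q ℕ.^ g
  path-avoiding-cut i (xs , (_ , linked) , avoids) = ℕ.≤-<-trans
    (descending-length (deleteDigit i ∘ height G) (descend linked avoids))
    (deleteDigit-< i (ℕ.<-≤-trans (height<size G (head xs)) size≤))
    where
      descend : ∀ {D} {xs : Vec Vertex D} → Linked _⟶_ xs → All (_∉ cutHeads i) xs →
                Linked (λ x v → deleteDigit i (height G v) ℕ.< deleteDigit i (height G x)) xs
      descend []  _ = []
      descend [-] _ = [-]
      descend (_∷_ {xs = _ ∷ _} x⟶v linked) (_ ∷ v∉ ∷ avoids) =
        -- A surviving edge is not of class `i`, since its head would then have been removed.
        deleteDigit-mono-< i (height-decreases G x⟶v) (λ leading → v∉ (∈cutHeads {i} (x⟶v , leading)))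
        ∷ descend linked (v∉ ∷ avoids)

-- Real numbers

/1-mono-< : ∀ {m n} → m ℕ.< n → (+ m / 1) ℚ.< (+ n / 1)
/1-mono-< {m} {n} m<n rewrite /1-normal m | /1-normal n =
  ℚ.*<* (ℤ.*-monoʳ-<-pos (+ 1) (ℤ.+<+ m<n))

0≤/1 : ∀ n → 0ℚ ℚ.≤ (+ n / 1)
0≤/1 n = /1-mono {0} {n} z≤n

1/1+_ : ℕ → ℚ
1/1+ d = mkℚ (+ 1) d (1-coprimeTo (suc d))

0<1/1+ : ∀ d → 0ℚ ℚ.< 1/1+ d
0<1/1+ d = ℚ.positive⁻¹ (1/1+ d)

-- For `q` with denominator `1 + d`, the fraction `1 / (2 + d)` is strictly below `1 / (1 + d)`,
-- hence below `q`.
1/1+-below : ∀ {q} → 0ℚ ℚ.< q → ∃ λ d → 1/1+ (suc d) ℚ.< q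
1/1+-below {mkℚ (+ zero) d _}     (ℚ.*<* (ℤ.+<+ ()))
1/1+-below {mkℚ (+ suc n) d _}    _ = d , ℚ.*<* (ℤ.+<+ (s≤s (begin
    suc (d ℕ.+ 0)                     ≡⟨ cong suc (ℕ.+-identityʳ d) ⟩
    suc d                             ≤⟨ ℕ.m≤m+n (suc d) (n ℕ.* suc (suc d)) ⟩
    suc d ℕ.+ n ℕ.* suc (suc d)       ∎)))
  where open ℕ.≤-Reasoning
1/1+-below {mkℚ -[1+ _ ] _ _} (ℚ.*<* ())

1/1+-∋ : ∀ x → ∃ λ d → value x ∋ (1/1+ (suc d))
1/1+-∋ x =
  let q , 0<q , x∋q = positive-rational x
      d , 1/<q = 1/1+-below 0<q
  in d , ℝ.downward (value x) 1/<q x∋q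

1/1+-*-assoc : ∀ d q → 1/1+ d ℚ.* ((+ suc d / 1) ℚ.* q) ≡ q
1/1+-*-assoc d q = begin
  1/1+ d ℚ.* ((+ suc d / 1) ℚ.* q)  ≡⟨ ℚ.*-assoc (1/1+ d) (+ suc d / 1) q ⟨
  1/1+ d ℚ.* (+ suc d / 1) ℚ.* q    ≡⟨ cong (λ p → 1/1+ d ℚ.* p ℚ.* q) (/1-normal (suc d)) ⟩
  1/1+ d ℚ.* integer (suc d) ℚ.* q  ≡⟨ cong (ℚ._* q) (ℚ.*-inverseʳ (1/1+ d)) ⟩
  1ℚ ℚ.* q                          ≡⟨ ℚ.*-identityˡ q ⟩
  q                                 ∎
  where open ≡-Reasoning

fromℕ≤*⁺ : ∀ (ε : ℝ⁺) d → value ε ∋ (1/1+ d) → ∀ s m .{{_ : NonZero m}} → suc d ℕ.* s ℕ.≤ m →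
           fromℕ s ≤ℝ value (ε *⁺ fromℕ⁺ m)
fromℕ≤*⁺ ε d ε∋ s m ds≤m {q} q<s with 0ℚ ℚ.<? q
... | yes 0<q = 1/1+ d , (+ suc d / 1) ℚ.* q , 0<1/1+ d ,
    ℚ.positive⁻¹ _ {{ℚ.pos*pos⇒pos (+ suc d / 1) {{1+d>0}} q {{ℚ.positive 0<q}}}} , ε∋ ,
    (begin-strict
      (+ suc d / 1) ℚ.* q            <⟨ ℚ.*-monoʳ-<-pos (+ suc d / 1) {{1+d>0}} q<s ⟩
      (+ suc d / 1) ℚ.* (+ s / 1)    ≡⟨ /1-* (suc d) s ⟨
      + (suc d ℕ.* s) / 1            ≤⟨ /1-mono ds≤m ⟩
      + m / 1                        ∎) ,
    ℚ.≤-reflexive (sym (1/1+-*-assoc d q))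
  where
    open ℚ.≤-Reasoning
    1+d>0 = ℚ.normalize-pos (suc d) 1
-- The product cut demands positive factors, so a nonpositive `q` is bounded by any positive product
-- available.
... | no 0≮q = let r , 0<r , r<m = ℚ.<-dense (/1-positive m) in
    1/1+ d , r , 0<1/1+ d , 0<r , ε∋ , r<m ,
    ℚ.≤-trans (ℚ.≮⇒≥ 0≮q) (ℚ.<⇒≤ (ℚ.positive⁻¹ _ {{ℚ.pos*pos⇒pos (1/1+ d) r {{ℚ.positive 0<r}}}}))

-- Given in lowest terms, so that an exponent `k / (1 + k)` in `_^ℝ_` reads literally as
-- `r ^ (1 + k) ≤ n ^ k`.
1-1/1+_ : ℕ → ℚ
1-1/1+ k = mkℚ (+ k) k λ {d} (d∣k , d∣1+k) →
  ∣1⇒≡1 (∣m+n∣m⇒∣n (subst (d ∣_) (ℕ.+-comm 1 k) d∣1+k) d∣k)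

1-1/1+<1 : ∀ k → 1-1/1+ k ℚ.< 1ℚ
1-1/1+<1 k = ℚ.*<* (subst₂ ℤ._<_ (sym (ℤ.*-identityʳ (+ k))) (sym (ℤ.*-identityˡ (+ suc k))) (ℤ.+<+ (ℕ.n<1+n k)))

fromℚ⁺ : ∀ q → 0ℚ ℚ.< q → ℝ⁺
fromℚ⁺ q 0<q = record { value = fromℚ q ; positive = 0ℚ , 0<q , ℚ.<-irrefl refl }

-- With tolerance `1 - q`, some `p ≥ 1` is at most `r + s` with `r` in `δ n` and `s < 1 - q`; then
-- `r ≤ q` would force `p < 1`.
converges-below : ∀ δ {q} → ConvergesTo δ 1ℝ → q ℚ.< 1ℚ → ∃ λ N → ∀ n → N ℕ.≤ n → δ n ∋ q
converges-below δ {q} δ→1 q<1 = N , λ n N≤n → below n (proj₁ (close n N≤n))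
  where
    q+[1-q]≡1 : q ℚ.+ (1ℚ ℚ.- q) ≡ 1ℚ
    q+[1-q]≡1 = trans (cong (q ℚ.+_) (ℚ.+-comm 1ℚ (ℚ.- q)))
      (trans (sym (ℚ.+-assoc q (ℚ.- q) 1ℚ)) (trans (cong (ℚ._+ 1ℚ) (ℚ.+-inverseʳ q)) (ℚ.+-identityˡ 1ℚ)))

    0<1-q : 0ℚ ℚ.< 1ℚ ℚ.- q
    0<1-q = subst (ℚ._< 1ℚ ℚ.- q) (ℚ.+-inverseʳ q) (ℚ.+-monoˡ-< (ℚ.- q) q<1)

    η = fromℚ⁺ (1ℚ ℚ.- q) 0<1-q
    N = proj₁ (δ→1 η)
    close = proj₂ (δ→1 η)

    below : ∀ n → 1ℝ <ℝ δ n +ℝ value η → δ n ∋ q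
    below n (p , (r , s , δn∋r , s<1-q , p≤r+s) , p≮1) with q ℚ.<? r
    ... | yes q<r = ℝ.downward (δ n) q<r δn∋r
    ... | no  q≮r = contradiction
      (subst (p ℚ.<_) q+[1-q]≡1 (ℚ.≤-<-trans p≤r+s (ℚ.+-mono-≤-< (ℚ.≮⇒≥ q≮r) s<1-q))) p≮1

-- Otherwise `2 + bD` is at most the power of `m` with exponent `k / (1 + k)`, so `1 + bD` lies in
-- the open cut `m ^ℝ x` and `D` in the product cut, giving `D < D`. One unit buys strictness, the
-- other a positive factor when `D` is zero.
*⁺-^ℝ-≤⇒ : ∀ (C : ℝ⁺) b → value C ∋ (1/1+ b) → ∀ m .{{_ : NonZero m}} x k → x ∋ (1-1/1+ k) →
  ∀ D → value (C *⁺ m ^ℝ x) ≤ℝ fromℕ D → m ℕ.^ k ℕ.< suc (suc (suc b ℕ.* D)) ℕ.^ suc k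
*⁺-^ℝ-≤⇒ C b C∋ m x k x∋ D Cmˣ≤D = ℕ.≰⇒> λ le → ℚ.<-irrefl refl (Cmˣ≤D
  (1/1+ b , + suc bD / 1 , 0<1/1+ b , /1-positive (suc bD) , C∋ ,
   (+ suc (suc bD) / 1 , 1-1/1+ k , /1-mono-< (ℕ.n<1+n (suc bD)) , 0≤/1 (suc (suc bD)) , x∋ ,
    subst (ℚ._≤ + (m ℕ.^ k) / 1) (/1-^ (suc (suc bD)) (suc k)) (/1-mono le)) ,
   (begin
     + D / 1                                     ≡⟨ 1/1+-*-assoc b (+ D / 1) ⟨
     1/1+ b ℚ.* ((+ suc b / 1) ℚ.* (+ D / 1))    ≡⟨ cong (1/1+ b ℚ.*_) (/1-* (suc b) D) ⟨
     1/1+ b ℚ.* (+ bD / 1)                       ≤⟨ ℚ.*-monoˡ-≤-nonNeg (1/1+ b) (/1-mono (ℕ.n≤1+n bD)) ⟩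
     1/1+ b ℚ.* (+ suc bD / 1)                   ∎)))
  where
    bD = suc b ℕ.* D
    open ℚ.≤-Reasoning

-- Arithmetic

root : ∀ k m → ∃ λ z → z ℕ.^ suc k ℕ.≤ m × m ℕ.< suc z ℕ.^ suc k
root k zero = 0 , z≤n , ℕ.≤-reflexive (sym (ℕ.^-zeroˡ (suc k)))
root k (suc m) with root k m
... | z , zᵏ≤m , m<wᵏ with suc m ℕ.<? suc z ℕ.^ suc k
...   | yes 1+m<wᵏ = z , ℕ.m≤n⇒m≤1+n zᵏ≤m , 1+m<wᵏ
...   | no  1+m≮wᵏ = suc z , ℕ.≮⇒≥ 1+m≮wᵏ , ℕ.≤-<-trans m<wᵏ (ℕ.^-monoˡ-< (suc k) (ℕ.n<1+n (suc z)))

^-cancelˡ-≤ : ∀ k {m n} → m ℕ.^ k ℕ.< suc n ℕ.^ k → m ℕ.≤ n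
^-cancelˡ-≤ k {m} {n} mᵏ<[1+n]ᵏ = ℕ.≮⇒≥ λ n<m → ℕ.<⇒≱ mᵏ<[1+n]ᵏ (ℕ.^-monoˡ-≤ k n<m)

^-distribʳ-* : ∀ k m n → (m ℕ.* n) ℕ.^ k ≡ m ℕ.^ k ℕ.* n ℕ.^ k
^-distribʳ-* zero    m n = refl
^-distribʳ-* (suc k) m n = trans
  (cong (m ℕ.* n ℕ.*_) (^-distribʳ-* k m n))
  (ℕ.[m*n]*[o*p]≡[m*o]*[n*p] m n (m ℕ.^ k) (n ℕ.^ k))

-- Since `z` is positive, replacing `suc z` by `2 z` costs a factor `2 ^ n`, which the extra factor
-- `z` absorbs together with `b`.
*-^-absorb : ∀ b n {z} .{{_ : NonZero b}} → b ℕ.* 2 ℕ.^ n ℕ.≤ z → b ℕ.* suc z ℕ.^ n ℕ.≤ z ℕ.^ suc n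
*-^-absorb b n {z} b2ⁿ≤z = begin
  b ℕ.* suc z ℕ.^ n              ≤⟨ ℕ.*-monoʳ-≤ b (ℕ.^-monoˡ-≤ n 1+z≤2z) ⟩
  b ℕ.* (2 ℕ.* z) ℕ.^ n          ≡⟨ cong (b ℕ.*_) (^-distribʳ-* n 2 z) ⟩
  b ℕ.* (2 ℕ.^ n ℕ.* z ℕ.^ n)    ≡⟨ ℕ.*-assoc b (2 ℕ.^ n) (z ℕ.^ n) ⟨
  b ℕ.* 2 ℕ.^ n ℕ.* z ℕ.^ n      ≤⟨ ℕ.*-monoˡ-≤ (z ℕ.^ n) b2ⁿ≤z ⟩
  z ℕ.^ suc n                    ∎
  where
    open ℕ.≤-Reasoning
    1+z≤2z : suc z ℕ.≤ 2 ℕ.* z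
    1+z≤2z = ℕ.+-mono-≤ (ℕ.≤-trans (ℕ.>-nonZero⁻¹ _ {{ℕ.m*n≢0 b (2 ℕ.^ n) {{it}} {{ℕ.m^n≢0 2 n}}}}) b2ⁿ≤z)
                        (ℕ.≤-reflexive (sym (ℕ.+-identityʳ z)))

-- Choice of parameters and the clash of the codepth bounds

theorem6 : (δ : ℕ → ℝ) →
    (∀ n → 0ℝ ≤ℝ δ n × δ n ≤ℝ 1ℝ) →
    ConvergesTo δ 1ℝ →
    (G : ℕ → DAG) →
    UniformlyBoundedInDegree G →
    ¬ IsExtenderSequence (λ n → n ^ℝ δ n) G
theorem6 δ _ δ→1 G (B , inDegree≤B) (size→∞ , ε , C , extender) =
  ℕ.<⇒≱ m^k<[2+bD]^1+k (begin
    suc (suc (b ℕ.* D)) ℕ.^ suc k   ≤⟨ ℕ.^-monoˡ-≤ (suc k) 2+bD≤z^k ⟩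
    (z ℕ.^ k) ℕ.^ suc k             ≡⟨ ℕ.^-*-assoc z k (suc k) ⟩
    z ℕ.^ (k ℕ.* suc k)             ≡⟨ cong (z ℕ.^_) (ℕ.*-comm k (suc k)) ⟩
    z ℕ.^ (suc k ℕ.* k)             ≡⟨ ℕ.^-*-assoc z (suc k) k ⟨
    (z ℕ.^ suc k) ℕ.^ k             ≤⟨ ℕ.^-monoˡ-≤ k z^1+k≤m ⟩
    m ℕ.^ k                         ∎)
  where
    open ℕ.≤-Reasoning

    -- 1 / a ∈ ε and 1 / b ∈ C; a cut into g + 1 = a (1 + B) classes has ∣ S ∣ ≤ m / a, and
    -- z is the integer part of m ^ (1 / (2 g + 2)).  The base is the square (1 + z) ^ 2 so
    -- that D < (1 + z) ^ (2 g) is of smaller order than m ^ (k / (1 + k)) ≥ z ^ (2 g + 1).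
    a₀ = proj₁ (1/1+-∋ ε)
    a = suc (suc a₀)
    b₀ = proj₁ (1/1+-∋ C)
    b = suc (suc b₀)
    g = B ℕ.+ suc a₀ ℕ.* suc B
    k = suc (2 ℕ.* g)
    L = b ℕ.* 2 ℕ.^ (2 ℕ.* g)
    N = proj₁ (converges-below δ δ→1 (1-1/1+<1 k))
    -- Size at least `N` puts `k / (1 + k)` below `δ m`; size at least `L ^ (1 + k)` forces the root
    -- `z` up to `L`, as `*-^-absorb` requires.
    n₀ = proj₁ (size→∞ (N ℕ.⊔ L ℕ.^ suc k))
    H = G n₀
    m = size H

    instance
      m≢0 : NonZero m
      m≢0 = DAG.nonEmpty H

    large : N ℕ.⊔ L ℕ.^ suc k ℕ.≤ m
    large = proj₂ (size→∞ (N ℕ.⊔ L ℕ.^ suc k)) n₀ ℕ.≤-refl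

    z = proj₁ (root k m)
    z^1+k≤m = proj₁ (proj₂ (root k m))
    m<[1+z]^1+k = proj₂ (proj₂ (root k m))

    L≤z : L ℕ.≤ z
    L≤z = ^-cancelˡ-≤ (suc k) (ℕ.≤-<-trans (ℕ.m⊔n≤o⇒n≤o N _ large) m<[1+z]^1+k)

    Q = suc z ℕ.^ 2

    m≤Q^1+g : m ℕ.≤ Q ℕ.^ suc g
    m≤Q^1+g = begin
      m                          ≤⟨ ℕ.<⇒≤ m<[1+z]^1+k ⟩
      suc z ℕ.^ suc k            ≡⟨ cong (suc z ℕ.^_) (ℕ.*-suc 2 g) ⟨
      suc z ℕ.^ (2 ℕ.* suc g)    ≡⟨ ℕ.^-*-assoc (suc z) 2 (suc g) ⟨
      Q ℕ.^ suc g                ∎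

    open DepthReduction H Q {g} m≤Q^1+g

    -- The bound is raised to `suc B` so that it can be cancelled even if `B` is zero.
    cut = smallCut {suc B} (λ v → ℕ.m≤n⇒m≤1+n (inDegree≤B n₀ v))
    S = cutHeads (proj₁ cut)

    a∣S∣≤m : a ℕ.* ∣ S ∣ ℕ.≤ m
    a∣S∣≤m = ℕ.*-cancelʳ-≤ _ _ (suc B) (begin
      a ℕ.* ∣ S ∣ ℕ.* suc B    ≡⟨ ℕ.*-assoc a ∣ S ∣ (suc B) ⟩
      a ℕ.* (∣ S ∣ ℕ.* suc B)  ≡⟨ cong (a ℕ.*_) (ℕ.*-comm ∣ S ∣ (suc B)) ⟩
      a ℕ.* (suc B ℕ.* ∣ S ∣)  ≡⟨ ℕ.*-assoc a (suc B) ∣ S ∣ ⟨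
      -- The number of classes `suc g` unfolds to `a ℕ.* suc B`.
      a ℕ.* suc B ℕ.* ∣ S ∣    ≤⟨ proj₂ cut ⟩
      m ℕ.* suc B              ∎)

    S⊂⊤ : S ⊂ ⊤
    -- Properness comes from `a ≥ 2` and `m > 0`: `a ∣ S ∣ ≤ m < a m`.
    S⊂⊤ = ∣p∣<n⇒p⊂⊤ (ℕ.*-cancelˡ-< a _ _ (ℕ.≤-<-trans a∣S∣≤m
      (subst (m ℕ.<_) (ℕ.*-comm m a) (ℕ.m<m*n m a (s≤s (s≤s z≤n))))))

    D = codepth (graph H) S S⊂⊤

    D<Q^g : D ℕ.< Q ℕ.^ g
    D<Q^g = path-avoiding-cut (proj₁ cut) (proj₁ (proj₂ (codepth-exists (graph H) S⊂⊤)))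

    2+bD≤z^k : suc (suc (b ℕ.* D)) ℕ.≤ z ℕ.^ k
    2+bD≤z^k = begin
      -- As `b ≥ 2`, the two extra units fit into one more multiple of `b`, matching the strict
      -- bound on `D`.
      2 ℕ.+ b ℕ.* D                  ≤⟨ ℕ.+-monoˡ-≤ (b ℕ.* D) (ℕ.m≤m+n 2 b₀) ⟩
      b ℕ.+ b ℕ.* D                  ≡⟨ ℕ.*-suc b D ⟨
      b ℕ.* suc D                    ≤⟨ ℕ.*-monoʳ-≤ b D<Q^g ⟩
      b ℕ.* Q ℕ.^ g                  ≡⟨ cong (b ℕ.*_) (ℕ.^-*-assoc (suc z) 2 g) ⟩
      b ℕ.* suc z ℕ.^ (2 ℕ.* g)      ≤⟨ *-^-absorb b (2 ℕ.* g) L≤z ⟩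
      z ℕ.^ k                        ∎

    m^k<[2+bD]^1+k : m ℕ.^ k ℕ.< suc (suc (b ℕ.* D)) ℕ.^ suc k
    m^k<[2+bD]^1+k = *⁺-^ℝ-≤⇒ C (suc b₀) (proj₂ (1/1+-∋ C)) m (δ m) k
      (proj₂ (converges-below δ δ→1 (1-1/1+<1 k)) m (ℕ.m⊔n≤o⇒m≤o N _ large)) D
      (extender n₀ S S⊂⊤ (fromℕ≤*⁺ ε (suc a₀) (proj₂ (1/1+-∋ ε)) ∣ S ∣ m a∣S∣≤m))
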